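{- For all integers $n\geq 1$, we have \[ \overline{\mathcal{EO}}(10n+r)\equiv 0 \pmod 2\quad\text{for } r\in\{2,4\}, \] and \[ \mathcal{EO}_u(10n+r)\equiv 0 \pmod 2\quad\text{for } r\in\{2,6\}. \]
   Context: For a positive integer $k$, let $f_k:=(q^k;q^k)_\infty=\prod_{i=1}^\infty(1-q^{ki})$ as a formal power series in $q$ (or for $|q|<1$). The integers $\overline{\mathcal{EO}}(n)$ and $\mathcal{EO}_u(n)$, $n\ge 0$, are given by the generating functions \[ \sum_{n=0}^\infty \overline{\mathcal{EO}}(n)q^n=\frac{f_4^3}{f_2^2},\qquad \sum_{n=0}^\infty \mathcal{EO}_u(n)q^n=\frac{f_4^2}{f_2^2}. \] (Combinatorially, $\overline{\mathcal{EO}}(n)$ counts partitions of $n$ in which each even part is less than each odd part and only the largest even part appears an odd number of times; the generating function above is a known theorem of Andrews and may be taken as the definition.) -}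

module Defs where

open import Data.Fin.Base using (Fin; zero; suc; toℕ; fromℕ; inject₁)
open import Data.Fin.Properties using (toℕ<n; toℕ-inject₁; toℕ-fromℕ)
open import Data.Integer.Base using (ℤ; 0ℤ; 1ℤ; _+_; _-_; _*_; -_)
import Data.Integer.Properties as ℤ
open import Data.Nat.Base as ℕ using (ℕ; zero; suc; _∸_; _≤_; _<_; NonZero; s≤s)
import Data.Nat.Properties as ℕ
open import Data.Vec.Base using (Vec; []; _∷_; head; lookup)
open import Algebra.Properties.Semiring.Sum ℤ.+-*-semiring
  using (sum; sum⁺-syntax; sum-init-last; sum-cong-≗; sum-replicate-zero)
open import Relation.Binary.PropositionalEquality
open import Relation.Nullary using (yes; no; contradiction)

-- A formal power series in q over ℤ, given by its coefficients:
-- a stands for Σₙ a n · qⁿ.  Equality of series is _≗_.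

Series : Set
Series = ℕ → ℤ

infix  8 q^_
infixl 6 _⊖_
infixl 7 _⊛_ _⊘_
infixr 8 _⊛^_

q^_ : ℕ → Series
(q^ m) n with n ℕ.≟ m
... | yes _ = 1ℤ
... | no  _ = 0ℤ

one : Series
one = q^ 0

_⊖_ : Series → Series → Series
(a ⊖ b) n = a n - b n

_⊛_ : Series → Series → Series
(a ⊛ b) n = ∑[ i ≤ n ] (a (toℕ i) * b (n ∸ toℕ i))

_⊛^_ : Series → ℕ → Series
a ⊛^ zero  = one
a ⊛^ suc m = a ⊛ a ⊛^ m

-- The multiplicative inverse of a series with constant term 1, computed by
-- b₀ = 1 and bₙ₊₁ = - Σ_{i ≤ n} aᵢ₊₁ bₙ₋ᵢ.  It is total, but only
-- meaningful when a 0 ≡ 1ℤ; see ⊛-inverseʳ.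
-- inverse≤ a n lists the coefficients bₙ , bₙ₋₁ , … , b₀ in this order.

inverse≤ : Series → (n : ℕ) → Vec ℤ (suc n)
inverse≤ a zero    = 1ℤ ∷ []
inverse≤ a (suc n) = - (∑[ i ≤ n ] (a (suc (toℕ i)) * lookup bs i)) ∷ bs
  where bs = inverse≤ a n

inverse : Series → Series
inverse a n = head (inverse≤ a n)

_⊘_ : Series → Series → Series
a ⊘ b = a ⊛ inverse b

-- ∏_{i=1}^{N} (1 - q^{ki})

partialProduct : ℕ → ℕ → Series
partialProduct k zero    = one
partialProduct k (suc N) = partialProduct k N ⊛ (one ⊖ q^ (k ℕ.* suc N))

-- f k = (q^k; q^k)_∞.  The factors with i > n do not affect the coefficient
-- of qⁿ, so it is read off the n-th partial product; see partialProduct-stable.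

f : (k : ℕ) .{{_ : NonZero k}} → Series
f k n = partialProduct k n n

EO-bar : ℕ → ℤ
EO-bar = f 4 ⊛^ 3 ⊘ f 2 ⊛^ 2

EO-u : ℕ → ℤ
EO-u = f 4 ⊛^ 2 ⊘ f 2 ⊛^ 2

lookup-inverse≤ : ∀ a n (i : Fin (suc n)) →
                  lookup (inverse≤ a n) i ≡ inverse a (n ∸ toℕ i)
lookup-inverse≤ a zero    zero    = refl
lookup-inverse≤ a (suc n) zero    = refl
lookup-inverse≤ a (suc n) (suc i) = lookup-inverse≤ a n i

⊛-inverseʳ : ∀ a → a 0 ≡ 1ℤ → a ⊛ inverse a ≗ one
⊛-inverseʳ a a₀≡1 zero    rewrite a₀≡1 = refl
⊛-inverseʳ a a₀≡1 (suc n) = begin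
  a 0 * - t + s  ≡⟨ cong (λ x → x * - t + s) a₀≡1 ⟩
  1ℤ * - t + s   ≡⟨ cong (_+ s) (ℤ.*-identityˡ (- t)) ⟩
  - t + s        ≡⟨ cong (- t +_) s≡t ⟩
  - t + t        ≡⟨ ℤ.+-inverseˡ t ⟩
  0ℤ             ∎
  where
  open ≡-Reasoning
  t = ∑[ i ≤ n ] (a (suc (toℕ i)) * lookup (inverse≤ a n) i)
  s = ∑[ i ≤ n ] (a (suc (toℕ i)) * inverse a (n ∸ toℕ i))
  s≡t : s ≡ t
  s≡t = sum-cong-≗ {suc n} λ i →
    cong (a (suc (toℕ i)) *_) (sym (lookup-inverse≤ a n i))

q^-off : ∀ {m n} → n ≢ m → (q^ m) n ≡ 0ℤ
q^-off {m} {n} n≢m with n ℕ.≟ m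
... | yes n≡m = contradiction n≡m n≢m
... | no  _   = refl

⊛-high : ∀ a {m n} → n < m → (a ⊛ (one ⊖ q^ m)) n ≡ a n
⊛-high a {m} {n} n<m = begin
  (a ⊛ b) n
    ≡⟨ sum-init-last t ⟩
  (∑ᵢ + t (fromℕ n))
    ≡⟨ cong₂ _+_ (trans (sum-cong-≗ {n} low) (sum-replicate-zero n)) top ⟩
  0ℤ + a n
    ≡⟨ ℤ.+-identityˡ (a n) ⟩
  a n ∎
  where
  open ≡-Reasoning
  b = one ⊖ q^ m
  t : Fin (suc n) → ℤ
  t i = a (toℕ i) * b (n ∸ toℕ i)
  ∑ᵢ = sum (λ (i : Fin n) → t (inject₁ i))
  b₀ : b 0 ≡ 1ℤ
  b₀ = cong (λ x → 1ℤ - x) (q^-off {m} {0} (ℕ.<⇒≢ (ℕ.≤-<-trans ℕ.z≤n n<m)))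
  b₊ : ∀ j → 0 < j → j ≤ n → b j ≡ 0ℤ
  b₊ j 0<j j≤n = cong₂ _-_ (q^-off {0} (ℕ.>⇒≢ 0<j))
                           (q^-off {m} (ℕ.<⇒≢ (ℕ.≤-<-trans j≤n n<m)))
  low : ∀ i → t (inject₁ i) ≡ 0ℤ
  low i rewrite toℕ-inject₁ i =
    trans (cong (a (toℕ i) *_)
                (b₊ (n ∸ toℕ i) (ℕ.m<n⇒0<n∸m (toℕ<n i)) (ℕ.m∸n≤m n (toℕ i))))
          (ℤ.*-zeroʳ (a (toℕ i)))
  top : t (fromℕ n) ≡ a n
  top rewrite toℕ-fromℕ n | ℕ.n∸n≡0 n =
    trans (cong (a n *_) b₀) (ℤ.*-identityʳ (a n))

partialProduct-stable : ∀ k .{{_ : NonZero k}} {n N} → n ≤ N →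
                        partialProduct k N n ≡ f k n
partialProduct-stable k {n} n≤N = go (ℕ.≤⇒≤′ n≤N)
  where
  go : ∀ {N} → n ℕ.≤′ N → partialProduct k N n ≡ f k n
  go (ℕ.≤′-reflexive refl)  = refl
  go (ℕ.≤′-step {N} n≤′N) =
    trans (⊛-high (partialProduct k N)
                  (ℕ.<-≤-trans (s≤s (ℕ.≤′⇒≤ n≤′N)) (ℕ.m≤n*m (suc N) k)))
          (go n≤′N)

{-# OPTIONS --safe #-}
module Submission where

-- Modulo 2, squaring f_k gives f_{2k}, so the two generating functions reduce
-- to f_8 and f_4.  By Euler's pentagonal number theorem q^j can occur in f_k
-- only if 24j + k = k s² for some s, and the residues of squares modulo 5
-- exclude the given progressions.  The pentagonal number theorem is obtained
-- from Shanks' identity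
--   Σ_{s=0}^{n} (-1)^s q^{sn + s(s+1)/2} ∏_{i=s+1}^{n} (1 - q^i)
--     = 1 + Σ_{t=1}^{n} (-1)^t (q^{t(3t-1)/2} + q^{t(3t+1)/2}),
-- whose left-hand side agrees with its term s = 0 up to q^n.

open import Defs
open import Data.Nat.Base using (ℕ; _+_; _*_; _≥_)
open import Data.Integer.Base using (+_)
open import Data.Integer.Divisibility using (_∣_)
open import Data.List.Base using (_∷_; [])
open import Data.List.Membership.Propositional using (_∈_)
open import Data.Product.Base using (_×_)

open import Algebra.Bundles using (CommutativeRing)
open import Algebra.Structures using (IsCommutativeRing; module IsAbelianGroup)
import Algebra.Consequences.Setoid as Consequences
import Algebra.Construct.Pointwise ℕ as Pointwise
import Algebra.Properties.Ring as RingProperties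
import Algebra.Solver.Ring.NaturalCoefficients.Default as NaturalCoefficients
open import Algebra.Properties.Semiring.Sum using (sum-cong-≗; sum-replicate-zero)
open import Data.Fin.Base using (toℕ)
open import Data.Fin.Properties using (toℕ<n)
open import Data.Integer.Base as ℤ using (ℤ; 0ℤ; 1ℤ)
import Data.Integer.Divisibility.Signed as Signed
import Data.Integer.Properties as ℤ
open import Data.Integer.Tactic.RingSolver using (solve-∀)
open import Data.List.Relation.Unary.All as All using (All; []; _∷_)
open import Data.List.Relation.Unary.Any using (here; there)
open import Data.Nat.Tactic.RingSolver using () renaming (solve-∀ to ℕ-solve-∀)
open import Data.Nat.Base using (zero; suc; _≤_; _<_; _∸_; s≤s; NonZero; z<s)
open import Data.Nat.DivMod using (_%_; %-distribˡ-*; [m+kn]%n≡m%n; m%n<n)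
import Data.Nat.Properties as ℕ
open import Data.Product.Base using (∃; _,_; proj₁; proj₂)
open import Function.Base using (_∘_)
open import Relation.Binary.PropositionalEquality
  using (_≡_; _≢_; _≗_; refl; sym; trans; subst; cong; cong₂; module ≡-Reasoning)
import Relation.Binary.Reasoning.Setoid as SetoidReasoning
open import Relation.Nullary using (yes; no; contradiction)

-- Formal power series over the integers as a commutative ring.

infixl 6 _⊕_
infix  8 ⊝_

_⊕_ : Series → Series → Series
(a ⊕ b) n = a n ℤ.+ b n

⊝_ : Series → Series
(⊝ a) n = ℤ.- a n

zeroˢ : Series
zeroˢ _ = 0ℤ

tail : Series → Series
tail a = a ∘ suc

-- Agreement is only asked up to degree n because `f k` agrees with a given partial product only up
-- to a bounded degree.
⊛-cong-≤ : ∀ {a a′ b b′} n → (∀ i → i ≤ n → a i ≡ a′ i) →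
           (∀ i → i ≤ n → b i ≡ b′ i) → (a ⊛ b) n ≡ (a′ ⊛ b′) n
⊛-cong-≤ n a≡a′ b≡b′ = sum-cong-≗ ℤ.+-*-semiring {suc n} λ i →
  cong₂ ℤ._*_ (a≡a′ (toℕ i) (ℕ.≤-pred (toℕ<n i)))
              (b≡b′ (n ∸ toℕ i) (ℕ.m∸n≤m n (toℕ i)))

⊛-cong : ∀ {a a′ b b′} → a ≗ a′ → b ≗ b′ → a ⊛ b ≗ a′ ⊛ b′
⊛-cong a≗a′ b≗b′ n = ⊛-cong-≤ n (λ i _ → a≗a′ i) (λ i _ → b≗b′ i)

⊛-zeroˡ : ∀ {a} b n → (∀ i → i ≤ n → a i ≡ 0ℤ) → (a ⊛ b) n ≡ 0ℤ
⊛-zeroˡ b n a≡0 = trans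
  (sum-cong-≗ ℤ.+-*-semiring {suc n} λ i →
    cong (ℤ._* b (n ∸ toℕ i)) (a≡0 (toℕ i) (ℕ.≤-pred (toℕ<n i))))
  (sum-replicate-zero ℤ.+-*-semiring (suc n))

-- (a ⊛ b) (suc n) unfolds to a 0 * b (suc n) + (tail a ⊛ b) n, so that
-- identities for ⊛ follow by induction on n; this is the mirror image.
⊛-sucʳ : ∀ a b n → (a ⊛ b) (suc n) ≡ a (suc n) ℤ.* b 0 ℤ.+ (a ⊛ tail b) n
⊛-sucʳ a b zero    = lemma (a 0) (b 1) (a 1) (b 0)
  where
  lemma : ∀ w x y z → w ℤ.* x ℤ.+ (y ℤ.* z ℤ.+ 0ℤ) ≡ y ℤ.* z ℤ.+ (w ℤ.* x ℤ.+ 0ℤ)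
  lemma = solve-∀
⊛-sucʳ a b (suc n) rewrite ⊛-sucʳ (tail a) b n =
  lemma (a 0 ℤ.* b (suc (suc n))) (a (suc (suc n)) ℤ.* b 0) ((tail a ⊛ tail b) n)
  where
  lemma : ∀ x y z → x ℤ.+ (y ℤ.+ z) ≡ y ℤ.+ (x ℤ.+ z)
  lemma = solve-∀

⊛-comm : ∀ a b → a ⊛ b ≗ b ⊛ a
⊛-comm a b zero    = cong (ℤ._+ 0ℤ) (ℤ.*-comm (a 0) (b 0))
⊛-comm a b (suc n) = trans
  (cong₂ ℤ._+_ (ℤ.*-comm (a 0) (b (suc n))) (⊛-comm (tail a) b n))
  (sym (⊛-sucʳ b a n))

⊛-distribʳ-⊕ : ∀ c a b → (a ⊕ b) ⊛ c ≗ a ⊛ c ⊕ b ⊛ c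
⊛-distribʳ-⊕ c a b zero    = lemma (a 0) (b 0) (c 0)
  where
  lemma : ∀ x y z → (x ℤ.+ y) ℤ.* z ℤ.+ 0ℤ ≡ (x ℤ.* z ℤ.+ 0ℤ) ℤ.+ (y ℤ.* z ℤ.+ 0ℤ)
  lemma = solve-∀
⊛-distribʳ-⊕ c a b (suc n) rewrite ⊛-distribʳ-⊕ c (tail a) (tail b) n =
  lemma (a 0) (b 0) (c (suc n)) ((tail a ⊛ c) n) ((tail b ⊛ c) n)
  where
  lemma : ∀ x y z u v → (x ℤ.+ y) ℤ.* z ℤ.+ (u ℤ.+ v) ≡
                        (x ℤ.* z ℤ.+ u) ℤ.+ (y ℤ.* z ℤ.+ v)
  lemma = solve-∀

⊛-scaleˡ : ∀ x a b n → ((λ i → x ℤ.* a i) ⊛ b) n ≡ x ℤ.* (a ⊛ b) n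
⊛-scaleˡ x a b zero    = lemma x (a 0) (b 0)
  where
  lemma : ∀ x y z → x ℤ.* y ℤ.* z ℤ.+ 0ℤ ≡ x ℤ.* (y ℤ.* z ℤ.+ 0ℤ)
  lemma = solve-∀
⊛-scaleˡ x a b (suc n) rewrite ⊛-scaleˡ x (tail a) b n =
  lemma x (a 0) (b (suc n)) ((tail a ⊛ b) n)
  where
  lemma : ∀ x y z u → x ℤ.* y ℤ.* z ℤ.+ x ℤ.* u ≡ x ℤ.* (y ℤ.* z ℤ.+ u)
  lemma = solve-∀

⊛-assoc : ∀ a b c → (a ⊛ b) ⊛ c ≗ a ⊛ (b ⊛ c)
⊛-assoc a b c zero    = lemma (a 0) (b 0) (c 0)
  where
  lemma : ∀ x y z → (x ℤ.* y ℤ.+ 0ℤ) ℤ.* z ℤ.+ 0ℤ ≡ x ℤ.* (y ℤ.* z ℤ.+ 0ℤ) ℤ.+ 0ℤ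
  lemma = solve-∀
⊛-assoc a b c (suc n) = begin
  (a 0 ℤ.* b 0 ℤ.+ 0ℤ) ℤ.* c (suc n) ℤ.+ (tail (a ⊛ b) ⊛ c) n
    -- `tail (a ⊛ b)` is definitionally the sum of `a 0` times `tail b` and `tail a ⊛ b`.
    ≡⟨ cong (λ s → (a 0 ℤ.* b 0 ℤ.+ 0ℤ) ℤ.* c (suc n) ℤ.+ s)
         (⊛-distribʳ-⊕ c (λ i → a 0 ℤ.* tail b i) (tail a ⊛ b) n) ⟩
  (a 0 ℤ.* b 0 ℤ.+ 0ℤ) ℤ.* c (suc n) ℤ.+
    (((λ i → a 0 ℤ.* tail b i) ⊛ c) n ℤ.+ ((tail a ⊛ b) ⊛ c) n)
    ≡⟨ cong₂ (λ s t → (a 0 ℤ.* b 0 ℤ.+ 0ℤ) ℤ.* c (suc n) ℤ.+ (s ℤ.+ t))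
         (⊛-scaleˡ (a 0) (tail b) c n) (⊛-assoc (tail a) b c n) ⟩
  (a 0 ℤ.* b 0 ℤ.+ 0ℤ) ℤ.* c (suc n) ℤ.+
    (a 0 ℤ.* (tail b ⊛ c) n ℤ.+ (tail a ⊛ (b ⊛ c)) n)
    ≡⟨ lemma (a 0) (b 0) (c (suc n)) ((tail b ⊛ c) n) ((tail a ⊛ (b ⊛ c)) n) ⟩
  a 0 ℤ.* (b ⊛ c) (suc n) ℤ.+ (tail a ⊛ (b ⊛ c)) n ∎
  where
  open ≡-Reasoning
  lemma : ∀ x y z u v → (x ℤ.* y ℤ.+ 0ℤ) ℤ.* z ℤ.+ (x ℤ.* u ℤ.+ v) ≡
                        x ℤ.* (y ℤ.* z ℤ.+ u) ℤ.+ v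
  lemma = solve-∀

⊛-identityˡ : ∀ a → one ⊛ a ≗ a
⊛-identityˡ a zero    = trans (ℤ.+-identityʳ _) (ℤ.*-identityˡ (a 0))
⊛-identityˡ a (suc n) = trans
  (cong₂ ℤ._+_ (ℤ.*-identityˡ (a (suc n))) (⊛-zeroˡ a n λ _ _ → refl))
  (ℤ.+-identityʳ (a (suc n)))

⊕-⊛-isCommutativeRing : IsCommutativeRing _≗_ _⊕_ _⊛_ ⊝_ zeroˢ one
⊕-⊛-isCommutativeRing = record
  { isRing = record
    { +-isAbelianGroup = +-isAbelianGroup
    ; *-cong           = ⊛-cong
    ; *-assoc          = ⊛-assoc
    ; *-identity       = comm∧idˡ⇒id ⊛-comm ⊛-identityˡ
    ; distrib          = comm∧distrʳ⇒distr ∙-cong ⊛-comm ⊛-distribʳ-⊕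
    }
  ; *-comm = ⊛-comm
  }
  where
  +-isAbelianGroup = Pointwise.isAbelianGroup ℤ.+-0-isAbelianGroup
  open IsAbelianGroup +-isAbelianGroup using (setoid; ∙-cong)
  open Consequences setoid using (comm∧idˡ⇒id; comm∧distrʳ⇒distr)

seriesRing : CommutativeRing _ _
seriesRing = record { isCommutativeRing = ⊕-⊛-isCommutativeRing }

module Series = CommutativeRing seriesRing

-- Powers of q.

q^-suc : ∀ m n → (q^ suc m) (suc n) ≡ (q^ m) n
q^-suc m n with suc n ℕ.≟ suc m | n ℕ.≟ m
... | yes _     | yes _   = refl
... | no  _     | no  _   = refl
... | yes 1+n≡1+m | no n≢m  = contradiction (ℕ.suc-injective 1+n≡1+m) n≢m
... | no  1+n≢1+m | yes n≡m = contradiction (cong suc n≡m) 1+n≢1+m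

q^-⊛-q^ : ∀ m p → q^ m ⊛ q^ p ≗ q^ (m + p)
q^-⊛-q^ zero    p n       = ⊛-identityˡ (q^ p) n
q^-⊛-q^ (suc m) p zero    = refl
q^-⊛-q^ (suc m) p (suc n) = begin
  0ℤ ℤ.+ (tail (q^ suc m) ⊛ q^ p) n  ≡⟨ ℤ.+-identityˡ _ ⟩
  (tail (q^ suc m) ⊛ q^ p) n         ≡⟨ ⊛-cong {b = q^ p} (q^-suc m) (λ _ → refl) n ⟩
  (q^ m ⊛ q^ p) n                    ≡⟨ q^-⊛-q^ m p n ⟩
  (q^ (m + p)) n                     ≡⟨ q^-suc (m + p) n ⟨
  (q^ suc (m + p)) (suc n)           ∎
  where open ≡-Reasoning

q^-⊛-low : ∀ {m n} a → n < m → (q^ m ⊛ a) n ≡ 0ℤ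
q^-⊛-low {m} {n} a n<m = ⊛-zeroˡ a n λ i i≤n →
  q^-off (ℕ.<⇒≢ (ℕ.≤-<-trans i≤n n<m))

-- Identities for Shanks' sum in an arbitrary commutative ring.

module _ {c ℓ} (R : CommutativeRing c ℓ) where

  open CommutativeRing R
    renaming ( _+_ to _+ʳ_; _*_ to _*ʳ_; -_ to -ʳ_; _-_ to _-ʳ_
             ; refl to ≈-refl; sym to ≈-sym; trans to ≈-trans)
  open RingProperties ring using (-1*x≈-x)
  open NaturalCoefficients commutativeSemiring using (solve; _:+_; _:*_; _:=_; con)
  open SetoidReasoning setoid

  private
    -1# = -ʳ 1#

    ⟨1-1⟩*_ : ∀ x → (1# +ʳ -1#) *ʳ x ≈ 0#
    ⟨1-1⟩* x = ≈-trans (*-congʳ (-‿inverseʳ 1#)) (zeroˡ x)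

    minus : ∀ x y → x -ʳ y ≈ x +ʳ -1# *ʳ y
    minus x y = +-congˡ (≈-sym (-1*x≈-x y))

  -- The solver knows no cancellation, so identities are solved with an
  -- indeterminate e for -1, up to explicit multiples of 1 + e.
  cancel : ∀ {x y} u v →
           x +ʳ (1# +ʳ -1#) *ʳ u ≈ y +ʳ (1# +ʳ -1#) *ʳ v → x ≈ y
  cancel {x} {y} u v eq = begin
    x                         ≈⟨ +-identityʳ x ⟨
    x +ʳ 0#                   ≈⟨ +-congˡ (⟨1-1⟩* u) ⟨
    x +ʳ (1# +ʳ -1#) *ʳ u     ≈⟨ eq ⟩
    y +ʳ (1# +ʳ -1#) *ʳ v     ≈⟨ +-congˡ (⟨1-1⟩* v) ⟩
    y +ʳ 0#                   ≈⟨ +-identityʳ y ⟩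
    y                         ∎

  -- The case t = 0 of `shanksSum-suc`; the factor `-ʳ 1# *ʳ 1#` is the unfolding of `-1ˢ ⊛^ 1`.
  shanks-base : ∀ z E → E *ʳ (1# -ʳ z) ≈ E +ʳ (-ʳ 1# *ʳ 1#) *ʳ (z *ʳ E)
  shanks-base z E = ≈-trans (*-congˡ (minus 1# z))
    (solve 3 (λ e z E → E :* (con 1 :+ e :* z) := E :+ (e :* con 1) :* (z :* E))
      ≈-refl -1# z E)

  -- After expansion the two terms in s X y² E cancel: this is the telescoping behind
  -- `shanksSum-suc`, where 1 - y is the lowest factor of one product and 1 - z the highest factor
  -- of the next.
  shanks-step : ∀ a s X y z E →
    (a +ʳ s *ʳ ((X *ʳ y) *ʳ ((1# -ʳ y) *ʳ E))) +ʳ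
      s *ʳ ((X *ʳ y *ʳ y) *ʳ (E *ʳ (1# -ʳ z))) ≈
    (a +ʳ s *ʳ ((X *ʳ y) *ʳ E)) +ʳ
      (-ʳ 1# *ʳ s) *ʳ ((X *ʳ y *ʳ y *ʳ z) *ʳ E)
  shanks-step a s X y z E = ≈-trans
    (+-cong (+-congˡ (*-congˡ (*-congˡ (*-congʳ (minus 1# y)))))
            (*-congˡ (*-congˡ (*-congˡ (minus 1# z)))))
    (cancel 0# (s *ʳ (X *ʳ y *ʳ y *ʳ E))
      (solve 7 (λ e a s X y z E →
        (a :+ s :* ((X :* y) :* ((con 1 :+ e :* y) :* E))) :+
          s :* ((X :* y :* y) :* (E :* (con 1 :+ e :* z))) :+
          (con 1 :+ e) :* con 0 :=
        (a :+ s :* ((X :* y) :* E)) :+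
          (e :* s) :* ((X :* y :* y :* z) :* E) :+
          (con 1 :+ e) :* (s :* (X :* y :* y :* E)))
        ≈-refl -1# a s X y z E))

  -- Congruence modulo 2.

  infix 4 _≈₂_

  -- Congruence modulo the ideal generated by 2. Half the difference is kept as data, so that for
  -- series the evenness of a coefficient can be read off from it.
  _≈₂_ : Carrier → Carrier → Set _
  x ≈₂ y = ∃ λ c → x ≈ y +ʳ (c +ʳ c)

  ≈⇒≈₂ : ∀ {x y} → x ≈ y → x ≈₂ y
  ≈⇒≈₂ {x} {y} x≈y = 0# ,
    ≈-trans x≈y (solve 1 (λ y → y := y :+ (con 0 :+ con 0)) ≈-refl y)

  ≈₂-trans : ∀ {x y z} → x ≈₂ y → y ≈₂ z → x ≈₂ z
  ≈₂-trans {x} {y} {z} (c , x≈) (d , y≈) = d +ʳ c , (begin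
    x                               ≈⟨ x≈ ⟩
    y +ʳ (c +ʳ c)                   ≈⟨ +-congʳ y≈ ⟩
    z +ʳ (d +ʳ d) +ʳ (c +ʳ c)       ≈⟨ solve 3 (λ c d z →
      z :+ (d :+ d) :+ (c :+ c) := z :+ ((d :+ c) :+ (d :+ c))) ≈-refl c d z ⟩
    z +ʳ ((d +ʳ c) +ʳ (d +ʳ c))     ∎)

  *-cong-≈₂ : ∀ {x y u v} → x ≈₂ y → u ≈₂ v → x *ʳ u ≈₂ y *ʳ v
  *-cong-≈₂ {x} {y} {u} {v} (c , x≈) (d , u≈) = c *ʳ (v +ʳ (d +ʳ d)) +ʳ y *ʳ d ,
    ≈-trans (*-cong x≈ u≈)
      (solve 4 (λ y c v d →
        (y :+ (c :+ c)) :* (v :+ (d :+ d)) :=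
        y :* v :+ ((c :* (v :+ (d :+ d)) :+ y :* d) :+
                   (c :* (v :+ (d :+ d)) :+ y :* d)))
        ≈-refl y c v d)

  -- The difference is 2 (x² - x). The square is a separate variable so that a single power of q can
  -- stand for it.
  [1-x]²≈₂1-x² : ∀ {x x²} → x *ʳ x ≈ x² → (1# -ʳ x) *ʳ (1# -ʳ x) ≈₂ 1# -ʳ x²
  [1-x]²≈₂1-x² {x} {x²} x*x≈x² = x *ʳ x +ʳ -1# *ʳ x , (begin
    (1# -ʳ x) *ʳ (1# -ʳ x)
      ≈⟨ *-cong (minus 1# x) (minus 1# x) ⟩
    (1# +ʳ -1# *ʳ x) *ʳ (1# +ʳ -1# *ʳ x)
      -- As polynomials in e and x the two sides differ by (e + 1)(e - 2) x², which dictates both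
      -- multiples of 1 + e.
      ≈⟨ cancel (x *ʳ x +ʳ x *ʳ x) (-1# *ʳ (x *ʳ x))
           (solve 2 (λ e x →
             (con 1 :+ e :* x) :* (con 1 :+ e :* x) :+
               (con 1 :+ e) :* (x :* x :+ x :* x) :=
             (con 1 :+ e :* (x :* x)) :+ ((x :* x :+ e :* x) :+ (x :* x :+ e :* x)) :+
               (con 1 :+ e) :* (e :* (x :* x)))
             ≈-refl -1# x) ⟩
    (1# +ʳ -1# *ʳ (x *ʳ x)) +ʳ ((x *ʳ x +ʳ -1# *ʳ x) +ʳ (x *ʳ x +ʳ -1# *ʳ x))
      ≈⟨ +-congʳ (≈-trans (≈-sym (minus 1# (x *ʳ x))) (+-congˡ (-‿cong x*x≈x²))) ⟩
    (1# -ʳ x²) +ʳ ((x *ʳ x +ʳ -1# *ʳ x) +ʳ (x *ʳ x +ʳ -1# *ʳ x)) ∎)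

  square-*-≈₂ : ∀ {p p′ w w′} →
    p *ʳ p ≈₂ p′ → w *ʳ w ≈₂ w′ → (p *ʳ w) *ʳ (p *ʳ w) ≈₂ p′ *ʳ w′
  square-*-≈₂ {p} {p′} {w} {w′} p²≈₂ w²≈₂ = ≈₂-trans
    (≈⇒≈₂ (solve 2 (λ p w → (p :* w) :* (p :* w) := (p :* p) :* (w :* w)) ≈-refl p w))
    (*-cong-≈₂ p²≈₂ w²≈₂)

  -- From h = g + 2c follows g v = h v - 2cv = 1 - 2cv, hence b v = a - 2acv.
  divide-≈₂ : ∀ {a b g h v} → b ≈ a *ʳ g → h ≈₂ g → h *ʳ v ≈ 1# → b *ʳ v ≈₂ a
  divide-≈₂ {a} {b} {g} {h} {v} b≈ (c , h≈) hv≈1 = d , (begin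
    b *ʳ v
      ≈⟨ *-congʳ b≈ ⟩
    (a *ʳ g) *ʳ v
      ≈⟨ cancel (a *ʳ c *ʳ v +ʳ a *ʳ c *ʳ v) 0#
           (solve 5 (λ e a g c v →
             (a :* g) :* v :+ (con 1 :+ e) :* (a :* c :* v :+ a :* c :* v) :=
             a :* ((g :+ (c :+ c)) :* v) :+ (e :* (a :* c :* v) :+ e :* (a :* c :* v)) :+
               (con 1 :+ e) :* con 0)
             ≈-refl -1# a g c v) ⟩
    a *ʳ ((g +ʳ (c +ʳ c)) *ʳ v) +ʳ (d +ʳ d)
      ≈⟨ +-congʳ (*-congˡ (*-congʳ h≈)) ⟨
    a *ʳ (h *ʳ v) +ʳ (d +ʳ d)
      ≈⟨ +-congʳ (*-congˡ hv≈1) ⟩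
    a *ʳ 1# +ʳ (d +ʳ d)
      ≈⟨ +-congʳ (*-identityʳ a) ⟩
    a +ʳ (d +ʳ d) ∎)
    where d = -1# *ʳ (a *ʳ c *ʳ v)

-- Shanks' identity.

-1ˢ : Series
-1ˢ = ⊝ one

-- Lets the signs (-1)^s be stripped before the exponents are examined.
-1^⊛-vanishes : ∀ t {a n} → a n ≡ 0ℤ → (-1ˢ ⊛^ t ⊛ a) n ≡ 0ℤ
-1^⊛-vanishes zero    {a} {n} an≡0 = trans (⊛-identityˡ a n) an≡0
-1^⊛-vanishes (suc t) {a} {n} an≡0 = begin
  ((-1ˢ ⊛ -1ˢ ⊛^ t) ⊛ a) n  ≡⟨ ⊛-assoc -1ˢ (-1ˢ ⊛^ t) a n ⟩
  (-1ˢ ⊛ (-1ˢ ⊛^ t ⊛ a)) n  ≡⟨ RingProperties.-1*x≈-x Series.ring (-1ˢ ⊛^ t ⊛ a) n ⟩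
  ℤ.- (-1ˢ ⊛^ t ⊛ a) n      ≡⟨ cong (λ x → ℤ.- x) (-1^⊛-vanishes t {a} {n} an≡0) ⟩
  0ℤ                        ∎
  where open ≡-Reasoning

triangle : ℕ → ℕ
triangle zero    = 0
triangle (suc t) = suc t + triangle t

2*triangle : ∀ t → 2 * triangle t ≡ t * suc t
2*triangle zero    = refl
2*triangle (suc t) = begin
  2 * (suc t + triangle t)      ≡⟨ ℕ.*-distribˡ-+ 2 (suc t) (triangle t) ⟩
  2 * suc t + 2 * triangle t    ≡⟨ cong (λ x → 2 * suc t + x) (2*triangle t) ⟩
  2 * suc t + t * suc t         ≡⟨ ℕ.*-distribʳ-+ (suc t) 2 t ⟨
  suc (suc t) * suc t           ≡⟨ ℕ.*-comm (suc (suc t)) (suc t) ⟩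
  suc t * suc (suc t)           ∎
  where open ≡-Reasoning

-- ∏_{i=s+1}^{s+m} (1 - q^{ki})
risingProduct : ℕ → ℕ → ℕ → Series
risingProduct k s zero    = one
risingProduct k s (suc m) = risingProduct k s m ⊛ (one ⊖ q^ (k * suc (s + m)))

risingProduct-0 : ∀ k m → risingProduct k 0 m ≡ partialProduct k m
risingProduct-0 k zero    = refl
risingProduct-0 k (suc m) = cong (_⊛ (one ⊖ q^ (k * suc m))) (risingProduct-0 k m)

-- The definition exposes the highest factor; exposing the lowest one makes the products in
-- consecutive terms of Shanks' sum share a common factor.
risingProduct-sucˡ : ∀ k s m →
  risingProduct k s (suc m) ≗ (one ⊖ q^ (k * suc s)) ⊛ risingProduct k (suc s) m
risingProduct-sucˡ k s zero rewrite ℕ.+-identityʳ s =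
  ⊛-comm one (one ⊖ q^ (k * suc s))
risingProduct-sucˡ k s (suc m) rewrite ℕ.+-suc s m =
  Series.trans (⊛-cong {b = w} (risingProduct-sucˡ k s m) (λ _ → refl))
               (⊛-assoc (one ⊖ q^ (k * suc s)) (risingProduct k (suc s) m) w)
  where w = one ⊖ q^ (k * suc (suc (s + m)))

-- A truncation of Shanks' sum:
-- Σ_{s=0}^{t} (-1)^s q^{k(sn + s(s+1)/2)} ∏_{i=s+1}^{n} (1 - q^{ki}), where n = t + m
shanksSum : ℕ → ℕ → ℕ → Series
shanksSum k zero    m = risingProduct k 0 m
shanksSum k (suc t) m = shanksSum k t (suc m) ⊕
  -1ˢ ⊛^ suc t ⊛
    (q^ (k * (suc t * suc (t + m) + triangle (suc t))) ⊛ risingProduct k (suc t) m)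

q^-* : ∀ k {n} m p → n ≡ m + p → q^ (k * n) ≗ q^ (k * m) ⊛ q^ (k * p)
q^-* k m p refl rewrite ℕ.*-distribˡ-+ k m p = Series.sym (q^-⊛-q^ (k * m) (k * p))

-- By induction on t, the increment of the earlier terms combines with the change in the last term
-- through `shanks-step`. For m = 0 the added product is empty and, with T = t + 1, the added
-- exponent is k T (3T - 1)/2.
shanksSum-suc : ∀ k t m → shanksSum k t (suc m) ≗ shanksSum k t m ⊕
  -1ˢ ⊛^ suc t ⊛ (q^ (k * (suc t * suc (t + m) + triangle t)) ⊛ risingProduct k t m)
shanksSum-suc k zero m
  rewrite ℕ.+-identityʳ (m + 0) | ℕ.+-identityʳ m =
  shanks-base seriesRing (q^ (k * suc m)) (risingProduct k 0 m)
shanksSum-suc k (suc t) m = begin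
  shanksSum k t (suc (suc m)) ⊕ σ ⊛ (q^ (k * e₂) ⊛ (E ⊛ (one ⊖ z)))
    ≈⟨ Series.+-cong
         (Series.trans (shanksSum-suc k t (suc m))
           (Series.+-congˡ {shanksSum k t (suc m)} (Series.*-congˡ {σ}
             (⊛-cong (q^-* k e₀ (suc t) e₁≡) (risingProduct-sucˡ k t m)))))
         (Series.*-congˡ {σ} (⊛-cong {b = E ⊛ (one ⊖ z)} (split₂ e₂≡) (λ _ → refl))) ⟩
  (shanksSum k t (suc m) ⊕ σ ⊛ ((X ⊛ y) ⊛ ((one ⊖ y) ⊛ E))) ⊕
    σ ⊛ ((X ⊛ y ⊛ y) ⊛ (E ⊛ (one ⊖ z)))
    ≈⟨ shanks-step seriesRing (shanksSum k t (suc m)) σ X y z E ⟩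
  (shanksSum k t (suc m) ⊕ σ ⊛ ((X ⊛ y) ⊛ E)) ⊕ (-1ˢ ⊛ σ) ⊛ ((X ⊛ y ⊛ y ⊛ z) ⊛ E)
    ≈⟨ Series.+-cong
         (Series.+-congˡ {shanksSum k t (suc m)} (Series.*-congˡ {σ}
           (⊛-cong {b = E} (q^-* k e₀ (suc t) e₁′≡) (λ _ → refl))))
         (Series.*-congˡ { -1ˢ ⊛ σ } (⊛-cong {b = E} split₃ (λ _ → refl))) ⟨
  shanksSum k (suc t) m ⊕ -1ˢ ⊛^ suc (suc t) ⊛
    (q^ (k * (suc (suc t) * suc (suc t + m) + triangle (suc t))) ⊛ E) ∎
  where
  open SetoidReasoning Series.setoid
  σ  = -1ˢ ⊛^ suc t
  E  = risingProduct k (suc t) m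
  e₀ = suc t * suc (t + m) + triangle t
  e₂ = suc t * suc (t + suc m) + triangle (suc t)
  X  = q^ (k * e₀)
  y  = q^ (k * suc t)
  z  = q^ (k * suc (suc t + m))
  arith₁ : ∀ t m u → suc t * suc (t + suc m) + u ≡ suc t * suc (t + m) + u + suc t
  arith₁ = ℕ-solve-∀
  arith₁′ : ∀ t m u → suc t * suc (t + m) + (suc t + u) ≡ suc t * suc (t + m) + u + suc t
  arith₁′ = ℕ-solve-∀
  arith₂ : ∀ t m u → suc t * suc (t + suc m) + (suc t + u) ≡
                     suc t * suc (t + m) + u + suc t + suc t
  arith₂ = ℕ-solve-∀
  arith₃ : ∀ t m u → suc (suc t) * suc (suc t + m) + (suc t + u) ≡
                     suc t * suc (t + m) + u + suc t + suc t + suc (suc t + m)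
  arith₃ = ℕ-solve-∀
  e₁≡  = arith₁ t m (triangle t)
  e₁′≡ = arith₁′ t m (triangle t)
  e₂≡  = arith₂ t m (triangle t)
  split₂ : ∀ {e} → e ≡ e₀ + suc t + suc t → q^ (k * e) ≗ X ⊛ y ⊛ y
  split₂ e≡ = Series.trans (q^-* k (e₀ + suc t) (suc t) e≡)
    (⊛-cong {b = y} (q^-* k e₀ (suc t) refl) (λ _ → refl))
  split₃ : q^ (k * (suc (suc t) * suc (suc t + m) + triangle (suc t))) ≗ X ⊛ y ⊛ y ⊛ z
  split₃ = Series.trans (q^-* k (e₀ + suc t + suc t) (suc (suc t + m)) (arith₃ t m (triangle t)))
    (⊛-cong {b = z} (split₂ refl) (λ _ → refl))

-- Each term with s ≥ 1 starts beyond q^(t + m), so only the term s = 0 contributes.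
shanksSum-≤ : ∀ k .{{_ : NonZero k}} t m {j} → j ≤ t + m →
              shanksSum k t m j ≡ partialProduct k (t + m) j
shanksSum-≤ k zero    m {j} _   = cong (λ p → p j) (risingProduct-0 k m)
shanksSum-≤ k (suc t) m {j} j≤ = begin
  shanksSum k t (suc m) j ℤ.+ (-1ˢ ⊛^ suc t ⊛ (q^ (k * e) ⊛ E)) j
    ≡⟨ cong₂ ℤ._+_
         (shanksSum-≤ k t (suc m) (ℕ.≤-trans j≤ (ℕ.≤-reflexive (sym (ℕ.+-suc t m)))))
         (-1^⊛-vanishes (suc t) {q^ (k * e) ⊛ E} {j} (q^-⊛-low E j<ke)) ⟩
  partialProduct k (t + suc m) j ℤ.+ 0ℤ
    ≡⟨ ℤ.+-identityʳ _ ⟩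
  partialProduct k (t + suc m) j
    ≡⟨ cong (λ N → partialProduct k N j) (ℕ.+-suc t m) ⟩
  partialProduct k (suc t + m) j ∎
  where
  E = risingProduct k (suc t) m
  e = suc t * suc (t + m) + triangle (suc t)
  j<ke : j < k * e
  j<ke = begin-strict
    j                              ≤⟨ j≤ ⟩
    suc (t + m)                    ≤⟨ ℕ.m≤n*m (suc (t + m)) (suc t) ⟩
    suc t * suc (t + m)            <⟨ ℕ.m<m+n (suc t * suc (t + m)) z<s ⟩
    e                              ≤⟨ ℕ.m≤n*m e k ⟩
    k * e                          ∎
    where open ℕ.≤-Reasoning
  open ≡-Reasoning

-- The pentagonal number theorem.

-- If j = k p with p a generalized pentagonal number, then
-- 24j + k = k(24p + 1), and 24p + 1 is a square.
NonPentagonal : ℕ → ℕ → Set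
NonPentagonal k j = ∀ s → 24 * j + k ≢ k * (s * s)

-- With T = t + 1 the exponent is k T (3T - 1)/2, and 12 T (3T - 1) + 1 = (6T - 1)².
24*pentagonal⁻+1 : ∀ k t → 24 * (k * (suc t * suc (t + 0) + triangle t)) + k ≡
                           k * ((6 * t + 5) * (6 * t + 5))
24*pentagonal⁻+1 k t = begin
  24 * (k * (suc t * suc (t + 0) + triangle t)) + k     ≡⟨ expand k t (triangle t) ⟩
  k * (24 * (suc t * suc t) + 12 * (2 * triangle t) + 1)
    ≡⟨ cong (λ x → k * (24 * (suc t * suc t) + 12 * x + 1)) (2*triangle t) ⟩
  k * (24 * (suc t * suc t) + 12 * (t * suc t) + 1)     ≡⟨ complete k t ⟩
  k * ((6 * t + 5) * (6 * t + 5))                       ∎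
  where
  open ≡-Reasoning
  expand : ∀ k t u → 24 * (k * (suc t * suc (t + 0) + u)) + k ≡
                     k * (24 * (suc t * suc t) + 12 * (2 * u) + 1)
  expand = ℕ-solve-∀
  complete : ∀ k t → k * (24 * (suc t * suc t) + 12 * (t * suc t) + 1) ≡
                     k * ((6 * t + 5) * (6 * t + 5))
  complete = ℕ-solve-∀

-- This exponent, k T (3T + 1)/2, exceeds the previous one by k T, which turns (6T - 1)² into (6T +
-- 1)².
24*pentagonal⁺+1 : ∀ k t → 24 * (k * (suc t * suc (t + 0) + triangle (suc t))) + k ≡
                           k * ((6 * t + 7) * (6 * t + 7))
24*pentagonal⁺+1 k t = begin
  24 * (k * (suc t * suc (t + 0) + (suc t + triangle t))) + k
    ≡⟨ expand k t (triangle t) ⟩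
  24 * (k * (suc t * suc (t + 0) + triangle t)) + k + 24 * (k * suc t)
    ≡⟨ cong (λ x → x + 24 * (k * suc t)) (24*pentagonal⁻+1 k t) ⟩
  k * ((6 * t + 5) * (6 * t + 5)) + 24 * (k * suc t)
    ≡⟨ complete k t ⟩
  k * ((6 * t + 7) * (6 * t + 7)) ∎
  where
  open ≡-Reasoning
  expand : ∀ k t u → 24 * (k * (suc t * suc (t + 0) + (suc t + u))) + k ≡
                     24 * (k * (suc t * suc (t + 0) + u)) + k + 24 * (k * suc t)
  expand = ℕ-solve-∀
  complete : ∀ k t → k * ((6 * t + 5) * (6 * t + 5)) + 24 * (k * suc t) ≡
                     k * ((6 * t + 7) * (6 * t + 7))
  complete = ℕ-solve-∀

-- At m = 0, passing from t to t + 1 adds two signed powers of q, since the products in the added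
-- terms are empty: one comes from `shanksSum-suc`, the other from the definition of the sum.
shanksSum-nonPentagonal : ∀ k t {j} → NonPentagonal k j → shanksSum k t 0 j ≡ 0ℤ
-- Here the sum is 1, and j = 0 is excluded because 24 · 0 + k = k · 1².
shanksSum-nonPentagonal k zero    ¬p = q^-off λ { refl → ¬p 1 (sym (ℕ.*-identityʳ k)) }
shanksSum-nonPentagonal k (suc t) {j} ¬p = begin
  shanksSum k t 1 j ℤ.+ term (triangle (suc t)) j
    ≡⟨ cong (λ x → x ℤ.+ term (triangle (suc t)) j) (shanksSum-suc k t 0 j) ⟩
  shanksSum k t 0 j ℤ.+ term (triangle t) j ℤ.+ term (triangle (suc t)) j
    ≡⟨ cong₂ ℤ._+_
         (cong₂ ℤ._+_ (shanksSum-nonPentagonal k t ¬p)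
           (term≡0 (triangle t) λ { refl → ¬p (6 * t + 5) (24*pentagonal⁻+1 k t) }))
         (term≡0 (triangle (suc t)) λ { refl → ¬p (6 * t + 7) (24*pentagonal⁺+1 k t) }) ⟩
  0ℤ ∎
  where
  open ≡-Reasoning
  term : ℕ → Series
  term u = -1ˢ ⊛^ suc t ⊛ (q^ (k * (suc t * suc (t + 0) + u)) ⊛ one)
  term≡0 : ∀ u → j ≢ k * (suc t * suc (t + 0) + u) → term u j ≡ 0ℤ
  term≡0 u j≢ = -1^⊛-vanishes (suc t) {q^ (k * (suc t * suc (t + 0) + u)) ⊛ one}
    (trans (Series.*-identityʳ (q^ (k * (suc t * suc (t + 0) + u))) j) (q^-off j≢))

f-nonPentagonal : ∀ k .{{_ : NonZero k}} j → NonPentagonal k j → f k j ≡ 0ℤ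
f-nonPentagonal k j ¬p = begin
  -- The coefficient of q^j is already visible for n = j, that is, for t = j and m = 0.
  partialProduct k j j        ≡⟨ partialProduct-stable k (ℕ.m≤m+n j 0) ⟨
  partialProduct k (j + 0) j  ≡⟨ shanksSum-≤ k j 0 (ℕ.m≤m+n j 0) ⟨
  shanksSum k j 0 j           ≡⟨ shanksSum-nonPentagonal k j ¬p ⟩
  0ℤ                          ∎
  where open ≡-Reasoning

-- Reduction of the generating functions modulo 2.

infix 4 _≡₂_

_≡₂_ : Series → Series → Set
_≡₂_ = _≈₂_ seriesRing

partialProduct-square : ∀ k N →
  partialProduct k N ⊛ partialProduct k N ≡₂ partialProduct (2 * k) N
partialProduct-square k zero    =
  ≈⇒≈₂ seriesRing {one ⊛ one} {one} (⊛-identityˡ one)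
partialProduct-square k (suc N) = square-*-≈₂ seriesRing
  {partialProduct k N} {partialProduct (2 * k) N} {one ⊖ x} {one ⊖ x²}
  (partialProduct-square k N) ([1-x]²≈₂1-x² seriesRing {x} {x²} x⊛x≗x²)
  where
  x  = q^ (k * suc N)
  x² = q^ (2 * k * suc N)
  double : ∀ k m → k * m + k * m ≡ 2 * k * m
  double = ℕ-solve-∀
  x⊛x≗x² : x ⊛ x ≗ x²
  x⊛x≗x² n = trans (q^-⊛-q^ (k * suc N) (k * suc N) n)
                   (cong (λ m → (q^ m) n) (double k (suc N)))

f-square : ∀ k .{{_ : NonZero k}} .{{_ : NonZero (2 * k)}} → f k ⊛ f k ≡₂ f (2 * k)
-- The witness is diagonal: its coefficient at n comes from the congruence for the n-th partial
-- products, which agree with the infinite products up to degree n.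
f-square k = (λ n → proj₁ (partialProduct-square k n) n) , λ n →
  trans (⊛-cong-≤ n (λ i i≤n → sym (partialProduct-stable k i≤n))
                    (λ i i≤n → sym (partialProduct-stable k i≤n)))
        (proj₂ (partialProduct-square k n) n)

⊛^-2 : ∀ a → a ⊛^ 2 ≗ a ⊛ a
⊛^-2 a = Series.*-congˡ {a} (Series.*-identityʳ a)

⊛^-3 : ∀ a → a ⊛^ 3 ≗ (a ⊛ a) ⊛ a
⊛^-3 a = Series.trans {a ⊛^ 3} (Series.*-congˡ {a} (⊛^-2 a)) (⊛-comm a (a ⊛ a))

f-⊛^-2 : ∀ k .{{_ : NonZero k}} .{{_ : NonZero (2 * k)}} → f k ⊛^ 2 ≡₂ f (2 * k)
f-⊛^-2 k = ≈₂-trans seriesRing {f k ⊛^ 2} {f k ⊛ f k} {f (2 * k)}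
  (≈⇒≈₂ seriesRing {f k ⊛^ 2} {f k ⊛ f k} (⊛^-2 (f k))) (f-square k)

⊘-≡₂ : ∀ a b g h → b ≗ a ⊛ g → h ≡₂ g → h 0 ≡ 1ℤ → b ⊘ h ≡₂ a
⊘-≡₂ a b g h b≗ h≡₂g h₀≡1 =
  divide-≈₂ seriesRing {a} {b} {g} {h} {inverse h} b≗ h≡₂g (⊛-inverseʳ h h₀≡1)

-- Since f_2² ≡ f_4, the quotient f_4² / f_2² reduces to f_4² / f_4.
EO-u≡₂f₄ : EO-u ≡₂ f 4
EO-u≡₂f₄ =
  -- The closing `refl` evaluates the constant term of f_2² to 1.
  ⊘-≡₂ (f 4) (f 4 ⊛^ 2) (f 4) (f 2 ⊛^ 2) (⊛^-2 (f 4)) (f-⊛^-2 2) refl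

-- f_4³ / f_2² ≡ f_4³ / f_4 = f_4² ≡ f_8.
EO-bar≡₂f₈ : EO-bar ≡₂ f 8
EO-bar≡₂f₈ = ≈₂-trans seriesRing {EO-bar} {f 4 ⊛ f 4} {f 8}
  (⊘-≡₂ (f 4 ⊛ f 4) (f 4 ⊛^ 3) (f 4) (f 2 ⊛^ 2) (⊛^-3 (f 4)) (f-⊛^-2 2) refl)
  (f-square 4)

nonPentagonal⇒even : ∀ a k .{{_ : NonZero k}} → a ≡₂ f k →
                     ∀ j → NonPentagonal k j → (+ 2) ∣ a j
nonPentagonal⇒even a k (d , a≗) j ¬p = Signed.∣⇒∣ᵤ (Signed.divides (d j) (begin
  a j                       ≡⟨ a≗ j ⟩
  f k j ℤ.+ (d j ℤ.+ d j)   ≡⟨ cong (λ x → x ℤ.+ (d j ℤ.+ d j)) (f-nonPentagonal k j ¬p) ⟩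
  0ℤ ℤ.+ (d j ℤ.+ d j)      ≡⟨ double (d j) ⟩
  d j ℤ.* + 2               ∎))
  where
  open ≡-Reasoning
  double : ∀ x → 0ℤ ℤ.+ (x ℤ.+ x) ≡ x ℤ.* + 2
  double = solve-∀

-- Squares modulo 5 and the four progressions.

square%5 : ∀ s → (s * s) % 5 ∈ 0 ∷ 1 ∷ 4 ∷ []
square%5 s = subst (λ x → x ∈ 0 ∷ 1 ∷ 4 ∷ []) {(s % 5 * (s % 5)) % 5} {(s * s) % 5}
  (sym (%-distribˡ-* s s 5)) (residues (s % 5) (m%n<n s 5))
  where
  residues : ∀ r → r < 5 → (r * r) % 5 ∈ 0 ∷ 1 ∷ 4 ∷ []
  residues 0 _ = here refl
  residues 1 _ = there (here refl)
  residues 2 _ = there (there (here refl))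
  residues 3 _ = there (there (here refl))
  residues 4 _ = there (here refl)
  residues (suc (suc (suc (suc (suc _))))) (s≤s (s≤s (s≤s (s≤s (s≤s ())))))

-- Reducing 24 j + k = k s² modulo 5 removes n, and s² can only be one of three residues, so a
-- finite check remains.
nonPentagonal-10n+r : ∀ k r n →
  All (λ x → (24 * r + k) % 5 ≢ (k % 5 * x) % 5) (0 ∷ 1 ∷ 4 ∷ []) →
  NonPentagonal k (10 * n + r)
nonPentagonal-10n+r k r n ≢s s eq = All.lookup ≢s (square%5 s) (begin
  (24 * r + k) % 5                  ≡⟨ [m+kn]%n≡m%n (24 * r + k) (48 * n) 5 ⟨
  (24 * r + k + 48 * n * 5) % 5     ≡⟨ cong (_% 5) (regroup k r n) ⟩
  (24 * (10 * n + r) + k) % 5       ≡⟨ cong (_% 5) eq ⟩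
  (k * (s * s)) % 5                 ≡⟨ %-distribˡ-* k (s * s) 5 ⟩
  (k % 5 * ((s * s) % 5)) % 5       ∎)
  where
  open ≡-Reasoning
  regroup : ∀ k r n → 24 * r + k + 48 * n * 5 ≡ 24 * (10 * n + r) + k
  regroup = ℕ-solve-∀

theorem3p1 : ∀ (n : ℕ) → n ≥ 1 →
    (∀ (r : ℕ) → r ∈ 2 ∷ 4 ∷ [] → (+ 2) ∣ EO-bar (10 * n + r)) ×
    (∀ (r : ℕ) → r ∈ 2 ∷ 6 ∷ [] → (+ 2) ∣ EO-u (10 * n + r))
theorem3p1 n _ = EO-bar-even , EO-u-even
  where
  even : ∀ a k .{{_ : NonZero k}} → a ≡₂ f k → ∀ r →
         All (λ x → (24 * r + k) % 5 ≢ (k % 5 * x) % 5) (0 ∷ 1 ∷ 4 ∷ []) →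
         (+ 2) ∣ a (10 * n + r)
  even a k a≡₂f r ≢s =
    nonPentagonal⇒even a k a≡₂f (10 * n + r) (nonPentagonal-10n+r k r n ≢s)
  EO-bar-even : ∀ r → r ∈ 2 ∷ 4 ∷ [] → (+ 2) ∣ EO-bar (10 * n + r)
  -- Modulo 5, 24 r + 8 is 1 for r = 2 and 4 for r = 4, while 8 x is 0, 3 or 2.
  EO-bar-even _ (here refl)         =
    even EO-bar 8 EO-bar≡₂f₈ 2 ((λ ()) ∷ (λ ()) ∷ (λ ()) ∷ [])
  EO-bar-even _ (there (here refl)) =
    even EO-bar 8 EO-bar≡₂f₈ 4 ((λ ()) ∷ (λ ()) ∷ (λ ()) ∷ [])
  EO-u-even : ∀ r → r ∈ 2 ∷ 6 ∷ [] → (+ 2) ∣ EO-u (10 * n + r)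
  -- Modulo 5, 24 r + 4 is 2 for r = 2 and 3 for r = 6, while 4 x is 0, 4 or 1.
  EO-u-even _ (here refl)         =
    even EO-u 4 EO-u≡₂f₄ 2 ((λ ()) ∷ (λ ()) ∷ (λ ()) ∷ [])
  EO-u-even _ (there (here refl)) =
    even EO-u 4 EO-u≡₂f₄ 6 ((λ ()) ∷ (λ ()) ∷ (λ ()) ∷ [])
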